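{- Let $k\geq 1$. There exists a positive real constant $C$ such that for any positive integer $n$ and any deterministic, accessible and complete transition structure $\mathcal{T}$ with $n$ states over a $k$-letter alphabet, for the uniform distribution over the sets $F\subseteq\{1,\dots,n\}$ of final states, the average number of iterations of the main loop of Moore's algorithm applied to $(\mathcal{T},F)$ is upper bounded by $C\log n$; that is, $$\frac{1}{2^n}\sum_{F\subseteq\{1,\dots,n\}}\textsc{Moore}(\mathcal{T},F)\le C\log n,$$ where $\textsc{Moore}(\mathcal{T},F)$ is the number of iterations of the main loop of Moore's algorithm on the automaton $(\mathcal{T},F)$.
   Context: A (deterministic, complete) transition structure $\mathcal{T}=(A,Q,\cdot,q_0)$ consists of a finite alphabet $A$, a finite set $Q$ of states, a total transition function $\cdot:Q\times A\to Q$ and an initial state $q_0\in Q$; with $n$ states, $Q=\{1,\dots,n\}$. The transition function is extended to words by $p\cdot\varepsilon=p$, $p\cdot(uv)=(p\cdot u)\cdot v$. It is accessible if every state is of the form $q_0\cdot u$ with $u\in A^*$. For $F\subseteq Q$, $(\mathcal{T},F)$ is the automaton $(A,Q,\cdot,q_0,F)$ with set of final states $F$. For a Boolean condition, $[\![\mathrm{Cond}]\!]$ is $1$ if the condition holds and $0$ otherwise. Moore's algorithm on $(\mathcal{T},F)$: (1) If $F=\emptyset$ or $F=\{1,\dots,n\}$, it stops immediately (returning a one-state automaton), with $0$ iterations of the main loop. (2) Otherwise set $\pi'[p]=[\![p\in F]\!]$ for every state $p$, and let $\pi$ be undefined (hence different from $\pi'$). (3) Main loop: while $\pi\ne\pi'$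 as partitions of the set of states, set $\pi=\pi'$ and compute the new partition $\pi'$ such that $\pi'[p]=\pi'[q]$ if and only if $\pi[p]=\pi[q]$ and $\pi[p\cdot a]=\pi[q\cdot a]$ for all $a\in A$. (4) Return the quotient of the automaton by the partition $\pi$. -}

module Defs where

open import Level using (0ℓ)
import Data.Bool.Properties as Bool
open import Data.Empty using (⊥; ⊥-elim)
open import Data.Fin using (Fin)
import Data.Fin.Properties as Fin
open import Data.Fin.Subset using (Subset; inside; outside) renaming (⊥ to ∅; ⊤ to full)
open import Data.Integer as ℤ using (+_)
import Data.Integer.Properties as ℤ
open import Data.List using (List; []; _∷_; _++_; map; allFin; cartesianProduct)
open import Data.List.Membership.Propositional using (_∈_)
open import Data.List.Membership.Propositional.Properties using (∈-allFin; ∈-cartesianProduct⁺)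
open import Data.List.Relation.Unary.Any using (here; there)
open import Data.Maybe using (Maybe; just; nothing)
open import Data.Nat as ℕ using (ℕ; zero; suc; NonZero; z≤n; s≤s; _^_; _⊔_; ⌊_/2⌋)
open import Data.Nat.Induction using (<-wellFounded)
open import Data.Nat.ListAction using (sum)
open import Data.Nat.Logarithm using (⌊log₂_⌋; ⌊log₂⌋-mono-≤; ⌊log₂[2^n]⌋≡n)
open import Data.Nat.Logarithm.Core using (⌊log2⌋)
import Data.Nat.Properties as ℕ
open import Data.Product using (∃; ∃-syntax; _×_; _,_; proj₁; proj₂)
open import Data.Rational as ℚ using (ℚ; mkℚ; 0ℚ; 1ℚ; ∣_∣)
import Data.Rational.Properties as ℚ
open import Data.Rational.Solver using (module +-*-Solver)
import Data.Rational.Unnormalised as ℚᵘ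
import Data.Rational.Unnormalised.Properties as ℚᵘ
open import Data.Sum using (_⊎_; inj₁; inj₂; [_,_]′)
open import Data.Vec using ([]; _∷_; lookup)
import Data.Vec.Properties as Vec
open import Function using (_⇔_; mk⇔; Equivalence)
open import Induction.WellFounded using (Acc; acc)
open import Relation.Binary using (Rel; IsDecEquivalence)
open import Relation.Binary.PropositionalEquality
  using (_≡_; refl; sym; trans; cong; subst; subst₂)
open import Relation.Nullary using (¬_; yes; no; contradiction)
open import Relation.Nullary.Decidable using (_×-dec_; _⊎-dec_; _→-dec_)
import Relation.Unary as U

-- Reals are Cauchy sequences of rationals, without a fixed modulus and
-- without quotienting: _≤ᴿ_ and Positiveᴿ depend only on the limits.
record ℝ : Set where
  constructor mkℝ
  field
    seq    : ℕ → ℚ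
    cauchy : ∀ ε → 0ℚ ℚ.< ε →
             ∃[ N ] ∀ m n → N ℕ.≤ m → N ℕ.≤ n → ∣ seq m ℚ.- seq n ∣ ℚ.≤ ε

open ℝ public

infix 4 _≤ᴿ_
infixl 7 _*ᴿ_

_≤ᴿ_ : ℝ → ℝ → Set
x ≤ᴿ y = ∀ ε → 0ℚ ℚ.< ε → ∃[ N ] ∀ n → N ℕ.≤ n → seq x n ℚ.≤ seq y n ℚ.+ ε

Positiveᴿ : ℝ → Set
Positiveᴿ x = ∃[ ε ] (0ℚ ℚ.< ε) × ∃[ N ] ∀ n → N ℕ.≤ n → ε ℚ.≤ seq x n

fromℚ : ℚ → ℝ
fromℚ q = mkℝ (λ _ → q) λ ε ε>0 → 0 , λ _ _ _ _ → begin
  ∣ q ℚ.- q ∣ ≡⟨ cong ∣_∣ (ℚ.+-inverseʳ q) ⟩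
  0ℚ          ≤⟨ ℚ.<⇒≤ ε>0 ⟩
  ε           ∎
  where open ℚ.≤-Reasoning

bounded : ∀ x → ∃[ B ] (0ℚ ℚ.< B) × ∃[ N ] ∀ n → N ℕ.≤ n → ∣ seq x n ∣ ℚ.≤ B
bounded x with cauchy x 1ℚ (ℚ.positive⁻¹ 1ℚ)
... | N , close = ∣ seq x N ∣ ℚ.+ 1ℚ
                , ℚ.+-mono-≤-< (ℚ.0≤∣p∣ (seq x N)) (ℚ.positive⁻¹ 1ℚ)
                , N , λ n N≤n → begin
  ∣ seq x n ∣
    ≡⟨ cong ∣_∣ (solve 2 (λ a b → a := b :+ (a :+ :- b)) refl (seq x n) (seq x N)) ⟩
  ∣ seq x N ℚ.+ (seq x n ℚ.- seq x N) ∣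
    ≤⟨ ℚ.∣p+q∣≤∣p∣+∣q∣ (seq x N) (seq x n ℚ.- seq x N) ⟩
  ∣ seq x N ∣ ℚ.+ ∣ seq x n ℚ.- seq x N ∣
    ≤⟨ ℚ.+-monoʳ-≤ ∣ seq x N ∣ (close n N N≤n ℕ.≤-refl) ⟩
  ∣ seq x N ∣ ℚ.+ 1ℚ ∎
  where
  open ℚ.≤-Reasoning
  open +-*-Solver

∣*∣-mono : ∀ {p q r s} → ∣ p ∣ ℚ.≤ r → ∣ q ∣ ℚ.≤ s → ∣ p ℚ.* q ∣ ℚ.≤ r ℚ.* s
∣*∣-mono {p} {q} {r} {s} p≤r q≤s = begin
  ∣ p ℚ.* q ∣       ≡⟨ ℚ.∣p*q∣≡∣p∣*∣q∣ p q ⟩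
  ∣ p ∣ ℚ.* ∣ q ∣   ≤⟨ ℚ.*-monoˡ-≤-nonNeg ∣ p ∣ {{ℚ.nonNegative (ℚ.0≤∣p∣ p)}} q≤s ⟩
  ∣ p ∣ ℚ.* s       ≤⟨ ℚ.*-monoʳ-≤-nonNeg s {{ℚ.nonNegative (ℚ.≤-trans (ℚ.0≤∣p∣ q) q≤s)}} p≤r ⟩
  r ℚ.* s           ∎
  where open ℚ.≤-Reasoning

ab-cd : ∀ a b c d → a ℚ.* b ℚ.- c ℚ.* d ≡ a ℚ.* (b ℚ.- d) ℚ.+ (a ℚ.- c) ℚ.* d
ab-cd = solve 4 (λ a b c d → a :* b :+ :- (c :* d)
                   := a :* (b :+ :- d) :+ (a :+ :- c) :* d) refl
  where open +-*-Solver

Aδ+δB : ∀ A B δ → A ℚ.* δ ℚ.+ δ ℚ.* B ≡ δ ℚ.* (A ℚ.+ B)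
Aδ+δB = solve 3 (λ A B δ → A :* δ :+ δ :* B := δ :* (A :+ B)) refl
  where open +-*-Solver

*-close : ∀ a b c d {A B δ} →
          ∣ a ∣ ℚ.≤ A → ∣ d ∣ ℚ.≤ B → ∣ a ℚ.- c ∣ ℚ.≤ δ → ∣ b ℚ.- d ∣ ℚ.≤ δ →
          ∣ a ℚ.* b ℚ.- c ℚ.* d ∣ ℚ.≤ δ ℚ.* (A ℚ.+ B)
*-close a b c d {A} {B} {δ} a≤A d≤B ac bd = begin
  ∣ a ℚ.* b ℚ.- c ℚ.* d ∣
    ≡⟨ cong ∣_∣ (ab-cd a b c d) ⟩
  ∣ a ℚ.* (b ℚ.- d) ℚ.+ (a ℚ.- c) ℚ.* d ∣
    ≤⟨ ℚ.∣p+q∣≤∣p∣+∣q∣ (a ℚ.* (b ℚ.- d)) ((a ℚ.- c) ℚ.* d) ⟩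
  ∣ a ℚ.* (b ℚ.- d) ∣ ℚ.+ ∣ (a ℚ.- c) ℚ.* d ∣
    ≤⟨ ℚ.+-mono-≤ (∣*∣-mono {a} {b ℚ.- d} a≤A bd) (∣*∣-mono {a ℚ.- c} {d} ac d≤B) ⟩
  A ℚ.* δ ℚ.+ δ ℚ.* B
    ≡⟨ Aδ+δB A B δ ⟩
  δ ℚ.* (A ℚ.+ B) ∎
  where open ℚ.≤-Reasoning

divide : ∀ ε S → 0ℚ ℚ.< ε → 0ℚ ℚ.< S → ∃[ δ ] (0ℚ ℚ.< δ) × δ ℚ.* S ≡ ε
divide ε S ε>0 S>0 = ε ℚ.* ℚ.1/ S
  , ℚ.positive⁻¹ (ε ℚ.* ℚ.1/ S)
      {{ℚ.pos*pos⇒pos ε {{ℚ.positive ε>0}} (ℚ.1/ S) {{ℚ.1/pos⇒pos S}}}}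
  , trans (ℚ.*-assoc ε (ℚ.1/ S) S)
      (trans (cong (ε ℚ.*_) (ℚ.*-inverseˡ S)) (ℚ.*-identityʳ ε))
  where
  instance
    S-pos : ℚ.Positive S
    S-pos = ℚ.positive S>0
    S-nz : ℚ.NonZero S
    S-nz = ℚ.pos⇒nonZero S

_*ᴿ_ : ℝ → ℝ → ℝ
x *ᴿ y = mkℝ (λ n → seq x n ℚ.* seq y n) close
  where
  close : ∀ ε → 0ℚ ℚ.< ε → ∃[ N ] ∀ m n → N ℕ.≤ m → N ℕ.≤ n →
          ∣ seq x m ℚ.* seq y m ℚ.- seq x n ℚ.* seq y n ∣ ℚ.≤ ε
  close ε ε>0 =
    let A , A>0 , N₁ , x≤A = bounded x
        B , B>0 , N₂ , y≤B = bounded y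
        δ , δ>0 , δS≡ε     = divide ε (A ℚ.+ B) ε>0 (ℚ.+-mono-< A>0 B>0)
        N₃ , dx            = cauchy x δ δ>0
        N₄ , dy            = cauchy y δ δ>0
        N                  = (N₁ ⊔ N₂) ⊔ (N₃ ⊔ N₄)
        l₁ = ℕ.≤-trans (ℕ.m≤m⊔n N₁ N₂) (ℕ.m≤m⊔n (N₁ ⊔ N₂) (N₃ ⊔ N₄))
        l₂ = ℕ.≤-trans (ℕ.m≤n⊔m N₁ N₂) (ℕ.m≤m⊔n (N₁ ⊔ N₂) (N₃ ⊔ N₄))
        l₃ = ℕ.≤-trans (ℕ.m≤m⊔n N₃ N₄) (ℕ.m≤n⊔m (N₁ ⊔ N₂) (N₃ ⊔ N₄))
        l₄ = ℕ.≤-trans (ℕ.m≤n⊔m N₃ N₄) (ℕ.m≤n⊔m (N₁ ⊔ N₂) (N₃ ⊔ N₄))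
    in N , λ m n N≤m N≤n →
      subst (∣ seq x m ℚ.* seq y m ℚ.- seq x n ℚ.* seq y n ∣ ℚ.≤_) δS≡ε
        (*-close (seq x m) (seq y m) (seq x n) (seq y n)
          (x≤A m (ℕ.≤-trans l₁ N≤m)) (y≤B n (ℕ.≤-trans l₂ N≤n))
          (dx m n (ℕ.≤-trans l₃ N≤m) (ℕ.≤-trans l₃ N≤n))
          (dy m n (ℕ.≤-trans l₄ N≤m) (ℕ.≤-trans l₄ N≤n)))

2*suc⌊n/2⌋≤2+n : ∀ n → 2 ℕ.* suc ⌊ n /2⌋ ℕ.≤ suc (suc n)
2*suc⌊n/2⌋≤2+n zero          = ℕ.≤-refl
2*suc⌊n/2⌋≤2+n (suc zero)    = s≤s (s≤s z≤n)
2*suc⌊n/2⌋≤2+n (suc (suc n)) = begin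
  2 ℕ.* suc (suc ⌊ n /2⌋)  ≡⟨ ℕ.*-suc 2 (suc ⌊ n /2⌋) ⟩
  2 ℕ.+ 2 ℕ.* suc ⌊ n /2⌋  ≤⟨ ℕ.+-monoʳ-≤ 2 (2*suc⌊n/2⌋≤2+n n) ⟩
  suc (suc (suc (suc n)))  ∎
  where open ℕ.≤-Reasoning

2^⌊log2⌋≤n : ∀ n (a : Acc ℕ._<_ n) → .{{_ : NonZero n}} → 2 ^ ⌊log2⌋ n a ℕ.≤ n
2^⌊log2⌋≤n 1             _        = ℕ.≤-refl
2^⌊log2⌋≤n (suc (suc n)) (acc rs) =
  ℕ.≤-trans (ℕ.*-monoʳ-≤ 2 (2^⌊log2⌋≤n (suc ⌊ n /2⌋) (rs (ℕ.⌊n/2⌋<n (suc n))))) (2*suc⌊n/2⌋≤2+n n)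

2^⌊log₂n⌋≤n : ∀ n → .{{_ : NonZero n}} → 2 ^ ⌊log₂ n ⌋ ℕ.≤ n
2^⌊log₂n⌋≤n n = 2^⌊log2⌋≤n n (<-wellFounded n)

n<2^[1+⌊log₂n⌋] : ∀ n → n ℕ.< 2 ^ suc ⌊log₂ n ⌋
n<2^[1+⌊log₂n⌋] n = ℕ.≰⇒> λ le → ℕ.<-irrefl refl
  (subst (ℕ._≤ ⌊log₂ n ⌋) (⌊log₂[2^n]⌋≡n (suc ⌊log₂ n ⌋)) (⌊log₂⌋-mono-≤ le))

log-approx-nat : ∀ n i j → .{{_ : NonZero n}} → .{{_ : NonZero i}} →
                 ⌊log₂ n ^ i ⌋ ℕ.* j ℕ.≤ suc ⌊log₂ n ^ j ⌋ ℕ.* i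
log-approx-nat n i j = ℕ.<⇒≤ (ℕ.≰⇒> λ le → ℕ.<-irrefl refl (begin-strict
  2 ^ (a ℕ.* j)          ≡⟨ ℕ.^-*-assoc 2 a j ⟨
  (2 ^ a) ^ j            ≤⟨ ℕ.^-monoˡ-≤ j (2^⌊log₂n⌋≤n (n ^ i) {{ℕ.m^n≢0 n i}}) ⟩
  (n ^ i) ^ j            ≡⟨ ℕ.^-*-assoc n i j ⟩
  n ^ (i ℕ.* j)          ≡⟨ cong (n ^_) (ℕ.*-comm i j) ⟩
  n ^ (j ℕ.* i)          ≡⟨ ℕ.^-*-assoc n j i ⟨
  (n ^ j) ^ i            <⟨ ℕ.^-monoˡ-< i (n<2^[1+⌊log₂n⌋] (n ^ j)) ⟩
  (2 ^ suc b) ^ i        ≡⟨ ℕ.^-*-assoc 2 (suc b) i ⟩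
  2 ^ (suc b ℕ.* i)      ≤⟨ ℕ.^-monoʳ-≤ 2 le ⟩
  2 ^ (a ℕ.* j)          ∎))
  where
  open ℕ.≤-Reasoning
  a b : ℕ
  a = ⌊log₂ n ^ i ⌋
  b = ⌊log₂ n ^ j ⌋

/-mono-≤ : ∀ a i b j → .{{_ : NonZero i}} → .{{_ : NonZero j}} →
           a ℕ.* j ℕ.≤ b ℕ.* i → + a ℚ./ i ℚ.≤ + b ℚ./ j
/-mono-≤ a (suc i) b (suc j) le = ℚ.toℚᵘ-cancel-≤ (begin
  ℚ.toℚᵘ (+ a ℚ./ suc i)  ≃⟨ ℚ.toℚᵘ-fromℚᵘ (ℚᵘ.mkℚᵘ (+ a) i) ⟩
  ℚᵘ.mkℚᵘ (+ a) i         ≤⟨ ℚᵘ.*≤* (subst₂ ℤ._≤_ (ℤ.pos-* a (suc j)) (ℤ.pos-* b (suc i)) (ℤ.+≤+ le)) ⟩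
  ℚᵘ.mkℚᵘ (+ b) j         ≃⟨ ℚ.toℚᵘ-fromℚᵘ (ℚᵘ.mkℚᵘ (+ b) j) ⟨
  ℚ.toℚᵘ (+ b ℚ./ suc j)  ∎)
  where open ℚᵘ.≤-Reasoning

/-suc : ∀ b j → + suc b ℚ./ suc j ≡ + b ℚ./ suc j ℚ.+ + 1 ℚ./ suc j
/-suc b j = ℚ.toℚᵘ-injective (begin
  ℚ.toℚᵘ (+ suc b ℚ./ suc j)
    ≈⟨ ℚ.toℚᵘ-fromℚᵘ (ℚᵘ.mkℚᵘ (+ suc b) j) ⟩
  ℚᵘ.mkℚᵘ (+ suc b) j
    ≈⟨ ℚᵘ.*≡* (trans (sym (ℤ.*-assoc (+ suc b) (+ suc j) (+ suc j)))
         (cong (ℤ._* + suc j) (trans (cong (ℤ._* + suc j) (ℤ.+-comm (+ 1) (+ b)))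
           (ℤ.*-distribʳ-+ (+ suc j) (+ b) (+ 1))))) ⟩
  ℚᵘ.mkℚᵘ (+ b) j ℚᵘ.+ ℚᵘ.mkℚᵘ (+ 1) j
    ≈⟨ ℚᵘ.+-cong (ℚ.toℚᵘ-fromℚᵘ (ℚᵘ.mkℚᵘ (+ b) j)) (ℚ.toℚᵘ-fromℚᵘ (ℚᵘ.mkℚᵘ (+ 1) j)) ⟨
  ℚ.toℚᵘ (+ b ℚ./ suc j) ℚᵘ.+ ℚ.toℚᵘ (+ 1 ℚ./ suc j)
    ≈⟨ ℚ.toℚᵘ-homo-+ (+ b ℚ./ suc j) (+ 1 ℚ./ suc j) ⟨
  ℚ.toℚᵘ (+ b ℚ./ suc j ℚ.+ + 1 ℚ./ suc j) ∎)
  where open import Relation.Binary.Reasoning.Setoid ℚᵘ.≃-setoid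

-- If l = ⌊log₂ nᵐ⌋ then 2ˡ ≤ nᵐ < 2ˡ⁺¹, that is, l/m ≤ log₂ n < l/m + 1/m.
-- Hence log₂-approx n j tends to log₂ n as j grows (take m = j + 1).
log₂-approx : ℕ → ℕ → ℚ
log₂-approx n j = + ⌊log₂ n ^ suc j ⌋ ℚ./ suc j

log₂-approx-≤ : ∀ n i j → .{{_ : NonZero n}} →
                log₂-approx n i ℚ.- log₂-approx n j ℚ.≤ + 1 ℚ./ suc j
log₂-approx-≤ n i j = begin
  x ℚ.- y                ≤⟨ ℚ.+-monoˡ-≤ (ℚ.- y) (/-mono-≤ ⌊log₂ n ^ suc i ⌋ (suc i)
                              (suc ⌊log₂ n ^ suc j ⌋) (suc j) (log-approx-nat n (suc i) (suc j))) ⟩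
  + suc ⌊log₂ n ^ suc j ⌋ ℚ./ suc j ℚ.- y
                         ≡⟨ cong (ℚ._- y) (/-suc ⌊log₂ n ^ suc j ⌋ j) ⟩
  (y ℚ.+ e) ℚ.- y        ≡⟨ solve 2 (λ y e → (y :+ e) :+ :- y := e) refl y e ⟩
  e                      ∎
  where
  open ℚ.≤-Reasoning
  open +-*-Solver
  x y e : ℚ
  x = log₂-approx n i
  y = log₂-approx n j
  e = + 1 ℚ./ suc j

log₂ : (n : ℕ) → .{{_ : NonZero n}} → ℝ
log₂ n = mkℝ (log₂-approx n) close
  where
  archimedean : ∀ ε → 0ℚ ℚ.< ε → ∃[ N ] ∀ j → N ℕ.≤ j → + 1 ℚ./ suc j ℚ.≤ ε
  archimedean (mkℚ (+ zero) d c) (ℚ.*<* (ℤ.+<+ lt)) = ⊥-elim (ℕ.n≮0 lt)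
  archimedean ε@(mkℚ (+ suc a) d c) _ = d , λ j d≤j →
    subst (+ 1 ℚ./ suc j ℚ.≤_) (ℚ.fromℚᵘ-toℚᵘ ε)
      (/-mono-≤ 1 (suc j) (suc a) (suc d) (ℕ.*-mono-≤ {1} {suc a} {suc d} {suc j} (s≤s z≤n) (s≤s d≤j)))
  archimedean (mkℚ (ℤ.-[1+ _ ]) d c) (ℚ.*<* ())

  close : ∀ ε → 0ℚ ℚ.< ε → ∃[ N ] ∀ m p → N ℕ.≤ m → N ℕ.≤ p →
          ∣ log₂-approx n m ℚ.- log₂-approx n p ∣ ℚ.≤ ε
  close ε ε>0 with archimedean ε ε>0
  ... | N , small = N , λ m p N≤m N≤p →
    [ (λ eq → subst (ℚ._≤ ε) (sym eq)
        (ℚ.≤-trans (log₂-approx-≤ n m p) (small p N≤p)))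
    , (λ eq → subst (ℚ._≤ ε)
        (sym (trans eq (solve 2 (λ a b → :- (a :+ :- b) := b :+ :- a) refl
                          (log₂-approx n m) (log₂-approx n p))))
        (ℚ.≤-trans (log₂-approx-≤ n p m) (small m N≤m)))
    ]′ (ℚ.∣p∣≡p∨∣p∣≡-p (log₂-approx n m ℚ.- log₂-approx n p))
    where open +-*-Solver

record TransitionStructure (k n : ℕ) : Set where
  infixl 7 _·_ _·*_
  field
    _·_ : Fin n → Fin k → Fin n
    q₀  : Fin n

  _·*_ : Fin n → List (Fin k) → Fin n
  p ·* []      = p
  p ·* (a ∷ u) = (p · a) ·* u

  Accessible : Set
  Accessible = ∀ q → ∃[ u ] q₀ ·* u ≡ q

-- p ∼ q stands for π[p] = π[q].
record Partition (n : ℕ) : Set₁ where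
  field
    _∼_              : Rel (Fin n) 0ℓ
    isDecEquivalence : IsDecEquivalence _∼_

  open IsDecEquivalence isDecEquivalence public
    using () renaming (refl to ∼-refl; sym to ∼-sym; trans to ∼-trans; _≟_ to _∼?_)

infix 4 _≐_

_≐_ : ∀ {n} → Partition n → Partition n → Set
π ≐ π′ = ∀ p q → Partition._∼_ π p q ⇔ Partition._∼_ π′ p q

-- π[p] = ⟦ p ∈ F ⟧; a subset is its vector of membership Booleans.
initial : ∀ {n} → Subset n → Partition n
initial F = record
  { _∼_              = λ p q → lookup F p ≡ lookup F q
  ; isDecEquivalence = record
    { isEquivalence = record { refl = refl ; sym = sym ; trans = trans }
    ; _≟_           = λ p q → lookup F p Bool.≟ lookup F q
    }
  }

module _ {k n : ℕ} (T : TransitionStructure k n) where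
  open TransitionStructure T

  refine : Partition n → Partition n
  refine π = record
    { _∼_              = λ p q → p ∼ q × (∀ a → (p · a) ∼ (q · a))
    ; isDecEquivalence = record
      { isEquivalence = record
        { refl  = ∼-refl , λ _ → ∼-refl
        ; sym   = λ (e , es) → ∼-sym e , λ a → ∼-sym (es a)
        ; trans = λ (e , es) (f , fs) → ∼-trans e f , λ a → ∼-trans (es a) (fs a)
        }
      ; _≟_           = λ p q → (p ∼? q) ×-dec Fin.all? (λ a → (p · a) ∼? (q · a))
      }
    }
    where open Partition π

  -- The loop runs while this fails; an undefined π differs from every π′.
  Unchanged : Maybe (Partition n) → Partition n → Set
  Unchanged nothing  π′ = ⊥
  Unchanged (just π) π′ = π ≐ π′

  -- Loop π π′ m: started with these values of the two variables, the main
  -- loop ends after exactly m iterations.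
  data Loop : Maybe (Partition n) → Partition n → ℕ → Set₁ where
    exit    : ∀ {π π′} → Unchanged π π′ → Loop π π′ 0
    iterate : ∀ {π π′ m} → ¬ Unchanged π π′ →
              Loop (just π′) (refine π′) m → Loop π π′ (suc m)

  data MooreRun (F : Subset n) : ℕ → Set₁ where
    trivial : F ≡ ∅ ⊎ F ≡ full → MooreRun F 0
    run     : ∀ {m} → ¬ (F ≡ ∅ ⊎ F ≡ full) →
              Loop nothing (initial F) m → MooreRun F m

-- Termination: each iteration but the last strictly decreases the number of
-- pairs of related states.

count : ∀ {A : Set} {P : U.Pred A 0ℓ} → U.Decidable P → List A → ℕ
count P? []       = 0
count P? (x ∷ xs) with P? x
... | yes _ = suc (count P? xs)
... | no  _ = count P? xs

module _ {A : Set} {P Q : U.Pred A 0ℓ} (P? : U.Decidable P) (Q? : U.Decidable Q)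
         (P⊆Q : ∀ {x} → P x → Q x) where

  count-≤ : ∀ xs → count P? xs ℕ.≤ count Q? xs
  count-≤ []       = z≤n
  count-≤ (x ∷ xs) with P? x | Q? x
  ... | yes _ | yes _ = s≤s (count-≤ xs)
  ... | yes p | no ¬q = contradiction (P⊆Q p) ¬q
  ... | no  _ | yes _ = ℕ.m≤n⇒m≤1+n (count-≤ xs)
  ... | no  _ | no  _ = count-≤ xs

  count-< : ∀ {x xs} → x ∈ xs → Q x → ¬ P x → count P? xs ℕ.< count Q? xs
  count-< {xs = y ∷ ys} (here refl) q ¬p with P? y | Q? y
  ... | yes p | _     = contradiction p ¬p
  ... | no  _ | no ¬q = contradiction q ¬q
  ... | no  _ | yes _ = s≤s (count-≤ ys)
  count-< {xs = y ∷ ys} (there x∈) q ¬p with P? y | Q? y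
  ... | yes _ | yes _ = s≤s (count-< x∈ q ¬p)
  ... | yes p | no ¬q = contradiction (P⊆Q p) ¬q
  ... | no  _ | yes _ = ℕ.m≤n⇒m≤1+n (count-< x∈ q ¬p)
  ... | no  _ | no  _ = count-< x∈ q ¬p

relatedPairs : ∀ {n} → Partition n → ℕ
relatedPairs {n} π = count (λ (p , q) → p ∼? q) (cartesianProduct (allFin n) (allFin n))
  where open Partition π

module _ {k n : ℕ} (T : TransitionStructure k n) where

  stable? : ∀ π → (∀ p q → Partition._∼_ π p q → Partition._∼_ (refine T π) p q) ⊎
                  (relatedPairs (refine T π) ℕ.< relatedPairs π)
  stable? π with Fin.all? (λ p → Fin.all? (λ q → (p ∼? q) →-dec (p ∼′? q)))
    where
    open Partition π
    open Partition (refine T π) using () renaming (_∼?_ to _∼′?_)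
  ... | yes st = inj₁ st
  ... | no ¬st with Fin.¬∀⟶∃¬ n _ (λ p → Fin.all? (λ q → (p ∼? q) →-dec (p ∼′? q))) ¬st
    where
    open Partition π
    open Partition (refine T π) using () renaming (_∼?_ to _∼′?_)
  ... | p , ¬st-p with Fin.¬∀⟶∃¬ n _ (λ q → (p ∼? q) →-dec (p ∼′? q)) ¬st-p
    where
    open Partition π
    open Partition (refine T π) using () renaming (_∼?_ to _∼′?_)
  ... | q , ¬imp with Partition._∼?_ π p q
  ... | no ¬p∼q = contradiction (λ p∼q → contradiction p∼q ¬p∼q) ¬imp
  ... | yes p∼q = inj₂ (count-<
          (λ (p , q) → Partition._∼?_ (refine T π) p q) (λ (p , q) → Partition._∼?_ π p q)
          proj₁ (∈-cartesianProduct⁺ (∈-allFin p) (∈-allFin q)) p∼q (λ p∼′q → ¬imp (λ _ → p∼′q)))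

  loop : ∀ π → Acc ℕ._<_ (relatedPairs π) → ∃ (Loop T (just π) (refine T π))
  loop π (acc rs) with stable? π
  ... | inj₁ st = 0 , exit (λ p q → mk⇔ (st p q) proj₁)
  ... | inj₂ lt with loop (refine T π) (rs lt)
  ... | m , l = suc m , iterate (λ same → ℕ.<-irrefl refl (ℕ.<-≤-trans lt
          (count-≤ (λ (p , q) → Partition._∼?_ π p q) (λ (p , q) → Partition._∼?_ (refine T π) p q)
            (λ {(p , q)} → Equivalence.to (same p q))
            (cartesianProduct (allFin n) (allFin n))))) l

  mooreRun : ∀ F → ∃ (MooreRun T F)
  mooreRun F with Vec.≡-dec Bool._≟_ F ∅ ⊎-dec Vec.≡-dec Bool._≟_ F full
  ... | yes triv = 0 , trivial triv
  ... | no ¬triv with loop (initial F) (<-wellFounded _)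
  ... | m , l = suc m , run ¬triv (iterate (λ ()) l)

  Moore : Subset n → ℕ
  Moore F = proj₁ (mooreRun F)

  Loop-unique : ∀ {π π′ m m′} → Loop T π π′ m → Loop T π π′ m′ → m ≡ m′
  Loop-unique (exit _)      (exit _)       = refl
  Loop-unique (exit same)   (iterate ¬s _) = contradiction same ¬s
  Loop-unique (iterate ¬s _) (exit same)   = contradiction same ¬s
  Loop-unique (iterate _ l) (iterate _ l′) = cong suc (Loop-unique l l′)

  Moore-unique : ∀ {F m} → MooreRun T F m → m ≡ Moore F
  Moore-unique {F} r = unique r (proj₂ (mooreRun F))
    where
    unique : ∀ {F m m′} → MooreRun T F m → MooreRun T F m′ → m ≡ m′
    unique (trivial _)  (trivial _)  = refl
    unique (trivial t)  (run ¬t _)   = contradiction t ¬t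
    unique (run ¬t _)   (trivial t)  = contradiction t ¬t
    unique (run _ l)    (run _ l′)   = Loop-unique l l′

subsets : ∀ n → List (Subset n)
subsets zero    = [] ∷ []
subsets (suc n) = map (outside ∷_) (subsets n) ++ map (inside ∷_) (subsets n)

average : ∀ {n} → (Subset n → ℕ) → ℚ
average {n} f = (+ sum (map f (subsets n)) ℚ./ (2 ^ n)) {{ℕ.m^n≢0 2 n}}

{-# OPTIONS --safe #-}

-- Let R_r be the partition after r refinements.  If Moore's algorithm makes at
-- least r + 2 iterations on (T, F), some pair (p, q) is related by R_r but not
-- by R_{r+1}.  Fix p, q, r and one such set F₀, and follow a word splitting p
-- from q: it yields pairs (p₀, q₀), …, (p_r, q_r) depending on F₀ only, on each
-- of which every F with p R_r q takes the same value.  The class of p_i in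
-- R_{r+1-i}(F₀) contains both or neither state of each earlier pair but
-- separates p_i from q_i; taking symmetric differences with it shows that each
-- pair halves the number of possible sets.  So at most 2^(n-r-1) sets F
-- separate p and q at step r + 1, and summing over the pairs (p, q) leaves a
-- geometric tail beyond 2 log₂ n iterations.
module Submission where

open import Defs
open import Algebra.Properties.CommutativeSemigroup using (interchange)
open import Data.Bool using (true; false; _xor_; if_then_else_)
open import Data.Bool.Properties using (xor-comm)
import Data.Bool.Properties as Bool
open import Data.Fin using (Fin)
open import Data.Fin.Properties using (any?; ¬∀⟶∃¬)
open import Data.Fin.Subset using (Subset; inside; outside)
open import Data.Fin.Subset.Properties using (anySubset?)
open import Data.Integer as ℤ using ()
import Data.Integer.Properties as ℤ
open import Data.List using (List; []; _∷_; _++_; map; length; allFin)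
open import Data.List.Membership.Propositional using (_∈_)
open import Data.List.Membership.Propositional.Properties using (∈-allFin)
open import Data.List.Properties using (map-++; map-∘; length-tabulate)
open import Data.List.Relation.Unary.All as All using (All; []; _∷_)
open import Data.List.Relation.Unary.Any using (here; there)
open import Data.Maybe using (just)
open import Data.Nat
  using (ℕ; zero; suc; pred; NonZero; _+_; _*_; _∸_; _^_; _⊓_; _≤_; _<_; z≤n; s≤s; s≤s⁻¹)
open import Data.Nat.ListAction using (sum)
open import Data.Nat.ListAction.Properties using (sum-++)
open import Data.Nat.Logarithm using (⌊log₂_⌋; ⌊log₂⌋-mono-≤; ⌊log₂[2^n]⌋≡n)
open import Data.Nat.Properties
open import Data.Nat.Tactic.RingSolver using (solve-∀)
open import Data.Product using (∃-syntax; _×_; _,_; proj₁; proj₂)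
open import Data.Rational as ℚ using (ℚ)
import Data.Rational.Properties as ℚ
import Data.Rational.Unnormalised as ℚᵘ
import Data.Rational.Unnormalised.Properties as ℚᵘ
open import Data.Sum using (inj₁; inj₂)
open import Data.Vec using ([]; _∷_; lookup; tabulate; zipWith)
open import Data.Vec.Properties using (lookup-zipWith; lookup∘tabulate)
open import Function using (_∘_; id; mk⇔)
open import Relation.Binary.PropositionalEquality
open import Relation.Nullary using (¬_; Dec; does; yes; no; contradiction)
open import Relation.Nullary.Decidable using (dec-true; does-⇔; ¬?; _×-dec_; decidable-stable)

open ≤-Reasoning

private variable
  n : ℕ

-- Sums over all subsets of the set of states, and indicators.

∑ : (Subset n → ℕ) → ℕ
∑ {zero}  g = g []
∑ {suc n} g = ∑ (g ∘ (outside ∷_)) + ∑ (g ∘ (inside ∷_))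

sum-subsets : ∀ n (g : Subset n → ℕ) → sum (map g (subsets n)) ≡ ∑ g
sum-subsets zero    g = +-identityʳ (g [])
sum-subsets (suc n) g = begin-equality
  sum (map g (map (outside ∷_) (subsets n) ++ map (inside ∷_) (subsets n)))
    ≡⟨ cong sum (map-++ g (map (outside ∷_) (subsets n)) _) ⟩
  sum (map g (map (outside ∷_) (subsets n)) ++ map g (map (inside ∷_) (subsets n)))
    ≡⟨ sum-++ (map g (map (outside ∷_) (subsets n))) _ ⟩
  sum (map g (map (outside ∷_) (subsets n))) + sum (map g (map (inside ∷_) (subsets n)))
    ≡⟨ cong₂ (λ xs ys → sum xs + sum ys) (map-∘ (subsets n)) (map-∘ (subsets n)) ⟨
  sum (map (g ∘ (outside ∷_)) (subsets n)) + sum (map (g ∘ (inside ∷_)) (subsets n))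
    ≡⟨ cong₂ _+_ (sum-subsets n _) (sum-subsets n _) ⟩
  ∑ g ∎

∑-mono : {f g : Subset n → ℕ} → (∀ F → f F ≤ g F) → ∑ f ≤ ∑ g
∑-mono {zero}  f≤g = f≤g []
∑-mono {suc n} f≤g = +-mono-≤ (∑-mono (f≤g ∘ (outside ∷_))) (∑-mono (f≤g ∘ (inside ∷_)))

∑-cong : {f g : Subset n → ℕ} → (∀ F → f F ≡ g F) → ∑ f ≡ ∑ g
∑-cong {zero}  f≡g = f≡g []
∑-cong {suc n} f≡g = cong₂ _+_ (∑-cong (f≡g ∘ (outside ∷_))) (∑-cong (f≡g ∘ (inside ∷_)))

∑-+ : (f g : Subset n → ℕ) → ∑ (λ F → f F + g F) ≡ ∑ f + ∑ g
∑-+ {zero}  f g = refl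
∑-+ {suc n} f g = trans
  (cong₂ _+_ (∑-+ (f ∘ (outside ∷_)) (g ∘ (outside ∷_))) (∑-+ (f ∘ (inside ∷_)) (g ∘ (inside ∷_))))
  (interchange +-commutativeSemigroup (∑ (f ∘ (outside ∷_))) _ _ _)

∑-const : ∀ n c → ∑ {n} (λ _ → c) ≡ 2 ^ n * c
∑-const zero    c = sym (+-identityʳ c)
∑-const (suc n) c = trans (cong₂ _+_ (∑-const n c) (∑-const n c)) (double (2 ^ n) c)
  where
  double : ∀ a c → a * c + a * c ≡ 2 * a * c
  double = solve-∀

infixl 6 _⊕_

_⊕_ : Subset n → Subset n → Subset n
_⊕_ = zipWith _xor_

-- Translation by `S` permutes the subsets: at each bit of `S` that is `inside`, the two halves of
-- the recursive sum change places.
∑-⊕ : (S : Subset n) (g : Subset n → ℕ) → ∑ (λ F → g (F ⊕ S)) ≡ ∑ g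
∑-⊕ []            g = refl
∑-⊕ (outside ∷ S) g = cong₂ _+_ (∑-⊕ S (g ∘ (outside ∷_))) (∑-⊕ S (g ∘ (inside ∷_)))
∑-⊕ (inside ∷ S)  g = trans
  (cong₂ _+_ (∑-⊕ S (g ∘ (inside ∷_))) (∑-⊕ S (g ∘ (outside ∷_))))
  (+-comm (∑ (g ∘ (inside ∷_))) _)

⟦_⟧ : ∀ {P : Set} → Dec P → ℕ
⟦ P? ⟧ = if does P? then 1 else 0

⟦⟧-mono : {P Q : Set} (P? : Dec P) (Q? : Dec Q) → (P → Q) → ⟦ P? ⟧ ≤ ⟦ Q? ⟧
⟦⟧-mono (no _)  _       _   = z≤n
⟦⟧-mono (yes _) (yes _) _   = ≤-refl
⟦⟧-mono (yes p) (no ¬q) P⇒Q = contradiction (P⇒Q p) ¬q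

⟦⟧-disjoint : {P Q R : Set} (P? : Dec P) (Q? : Dec Q) (R? : Dec R) →
              (P → R) → (Q → R) → (P → ¬ Q) → ⟦ P? ⟧ + ⟦ Q? ⟧ ≤ ⟦ R? ⟧
⟦⟧-disjoint (no _)  Q?      R? _   Q⇒R _   = ⟦⟧-mono Q? R? Q⇒R
⟦⟧-disjoint (yes p) (no _)  R? P⇒R _   _   = ⟦⟧-mono (yes p) R? P⇒R
⟦⟧-disjoint (yes p) (yes q) _  _   _   P⇒¬Q = contradiction q (P⇒¬Q p)

⟦yes⟧ : {P : Set} (P? : Dec P) → P → 1 ≤ ⟦ P? ⟧
⟦yes⟧ P? p rewrite dec-true P? p = ≤-refl

-- Counting the sets that agree with an acyclic graph.

-- A list of pairs of states is a graph on the states; a set agrees with it if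
-- it is constant on each connected component.
Agree : Subset n → List (Fin n × Fin n) → Set
Agree F = All λ (x , y) → lookup F x ≡ lookup F y

agree? : ∀ (F : Subset n) es → Dec (Agree F es)
agree? F = All.all? λ (x , y) → lookup F x Bool.≟ lookup F y

-- Acyclicity: S certifies that x and y are not connected by the edges es.
data Acyclic {n} : List (Fin n × Fin n) → Set where
  []  : Acyclic []
  add : ∀ {x y es} (S : Subset n) → Agree S es → lookup S x ≢ lookup S y →
        Acyclic es → Acyclic ((x , y) ∷ es)

xor-cancelˡ : ∀ a {b c} → a xor b ≡ a xor c → b ≡ c
xor-cancelˡ false eq = eq
xor-cancelˡ true {false} {false} _ = refl
xor-cancelˡ true {true}  {true}  _ = refl

xor-cancelʳ : ∀ {a b} c → a xor c ≡ b xor c → a ≡ b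
xor-cancelʳ {a} {b} c eq = xor-cancelˡ c (trans (xor-comm c a) (trans eq (xor-comm b c)))

module _ {S : Subset n} where

  ⊕-agree : ∀ {F : Subset n} {x y} → lookup S x ≡ lookup S y →
            lookup (F ⊕ S) x ≡ lookup (F ⊕ S) y → lookup F x ≡ lookup F y
  ⊕-agree {F} {x} {y} Sx≡Sy eq = xor-cancelʳ (lookup S x) (trans
    (sym (lookup-zipWith _xor_ x F S))
    (trans eq (trans (lookup-zipWith _xor_ y F S) (cong (lookup F y xor_) (sym Sx≡Sy)))))

  ⊕-separates : ∀ {F : Subset n} {x y} → lookup F x ≡ lookup F y →
                lookup (F ⊕ S) x ≡ lookup (F ⊕ S) y → lookup S x ≡ lookup S y
  ⊕-separates {F} {x} {y} Fx≡Fy eq = xor-cancelˡ (lookup F x) (trans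
    (sym (lookup-zipWith _xor_ x F S))
    (trans eq (trans (lookup-zipWith _xor_ y F S) (cong (_xor lookup S y) (sym Fx≡Fy)))))

-- Each edge at least halves the count. If `F` agrees with the graph including the new edge, then
-- `F ⊕ S` still agrees with the old edges, as `S` does, but fails on the new one, which `S`
-- separates. So the old graph admits at least twice as many sets.
acyclic-count : ∀ {es : List (Fin n × Fin n)} → Acyclic es →
                ∑ (λ F → ⟦ agree? F es ⟧) * 2 ^ length es ≤ 2 ^ n
acyclic-count {n} [] = ≤-reflexive (trans (*-identityʳ _) (trans (∑-const n 1) (*-identityʳ (2 ^ n))))
acyclic-count {n} {es = (x , y) ∷ es} (add S S-agrees Sx≢Sy ac) = begin
  N₁ * (2 * 2 ^ length es)   ≡⟨ double N₁ (2 ^ length es) ⟩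
  (N₁ + N₁) * 2 ^ length es  ≡⟨ cong (λ m → (N₁ + m) * 2 ^ length es) (∑-⊕ S h) ⟨
  (N₁ + ∑ (λ F → h (F ⊕ S))) * 2 ^ length es
                             ≡⟨ cong (_* 2 ^ length es) (∑-+ h (λ F → h (F ⊕ S))) ⟨
  ∑ (λ F → h F + h (F ⊕ S)) * 2 ^ length es
                             ≤⟨ *-monoˡ-≤ (2 ^ length es) (∑-mono halve) ⟩
  ∑ (λ F → ⟦ agree? F es ⟧) * 2 ^ length es
                             ≤⟨ acyclic-count ac ⟩
  2 ^ n                      ∎
  where
  h : Subset n → ℕ
  h F = ⟦ agree? F ((x , y) ∷ es) ⟧
  N₁ = ∑ h
  double : ∀ a b → a * (2 * b) ≡ (a + a) * b
  double = solve-∀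
  agree-⊕ : ∀ F → Agree (F ⊕ S) es → Agree F es
  agree-⊕ F F⊕S-agrees =
    All.zipWith (λ (Sx≡Sy , eq) → ⊕-agree {F = F} Sx≡Sy eq) (S-agrees , F⊕S-agrees)
  halve : ∀ F → h F + h (F ⊕ S) ≤ ⟦ agree? F es ⟧
  halve F = ⟦⟧-disjoint (agree? F ((x , y) ∷ es)) (agree? (F ⊕ S) ((x , y) ∷ es)) (agree? F es)
    All.tail (λ as → agree-⊕ F (All.tail as))
    (λ as as′ → Sx≢Sy (⊕-separates {F = F} (All.head as) (All.head as′)))

-- Union bound and summation of a geometric tail.

∈⇒≤sum : ∀ {A : Set} (g : A → ℕ) {x xs} → x ∈ xs → g x ≤ sum (map g xs)
∈⇒≤sum g {xs = y ∷ ys} (here refl) = m≤m+n (g y) _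
∈⇒≤sum g {xs = y ∷ ys} (there x∈ys) = ≤-trans (∈⇒≤sum g x∈ys) (m≤n+m _ (g y))

∑-sum-bound : ∀ {A : Set} (h : A → Subset n → ℕ) c K → (∀ x → ∑ (h x) * c ≤ K) →
              ∀ xs → ∑ (λ F → sum (map (λ x → h x F) xs)) * c ≤ length xs * K
∑-sum-bound {n} h c K h≤ [] =
  ≤-reflexive (cong (_* c) (trans (∑-const n 0) (*-zeroʳ (2 ^ n))))
∑-sum-bound h c K h≤ (x ∷ xs) = begin
  ∑ (λ F → h x F + rest F) * c  ≡⟨ cong (_* c) (∑-+ (h x) rest) ⟩
  (∑ (h x) + ∑ rest) * c        ≡⟨ *-distribʳ-+ c (∑ (h x)) (∑ rest) ⟩
  ∑ (h x) * c + ∑ rest * c      ≤⟨ +-mono-≤ (h≤ x) (∑-sum-bound h c K h≤ xs) ⟩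
  K + length xs * K             ∎
  where
  rest = λ F → sum (map (λ x → h x F) xs)

≤∑ : (f : Subset n → ℕ) → ∀ F → f F ≤ ∑ f
≤∑ f []            = ≤-refl
≤∑ f (outside ∷ F) = ≤-trans (≤∑ (f ∘ (outside ∷_)) F) (m≤m+n _ _)
≤∑ f (inside ∷ F)  = ≤-trans (≤∑ (f ∘ (inside ∷_)) F) (m≤n+m _ (∑ (f ∘ (outside ∷_))))

-- 1 ⊓ (m ∸ s) is the indicator of s < m.
∑-geometric : ∀ (f : Subset n → ℕ) A K →
              (∀ s → ∑ (λ F → 1 ⊓ (f F ∸ s)) * (A * 2 ^ s) ≤ K) → ∑ f * A ≤ 2 * K
∑-geometric {n} f A K = go (∑ f) f A (≤∑ f)
  where
  double : ∀ a b → 2 * (a * b) ≡ a * (2 * b)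
  double = solve-∀
  1⊓m+pred[m]≡m : ∀ m → m ≡ 1 ⊓ m + pred m
  1⊓m+pred[m]≡m zero    = refl
  1⊓m+pred[m]≡m (suc m) = refl
  swap-2 : ∀ A B → 2 * A * B ≡ A * (2 * B)
  swap-2 = solve-∀
  pred[m]∸n : ∀ m n → pred m ∸ n ≡ m ∸ suc n
  pred[m]∸n zero    n = 0∸n≡0 n
  pred[m]∸n (suc m) n = refl
  -- Induction on a bound `M` for `f`. Splitting off the indicator of 0 < f leaves `pred ∘ f`, whose
  -- tails are those of `f` shifted by one; they satisfy the hypothesis with weight `2 * A`, so both
  -- summands are at most `K`.
  go : ∀ M (f : Subset n → ℕ) A → (∀ F → f F ≤ M) →
       (∀ s → ∑ (λ F → 1 ⊓ (f F ∸ s)) * (A * 2 ^ s) ≤ K) → ∑ f * A ≤ 2 * K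
  go zero f A f≤0 _ = begin
    ∑ f * A                ≤⟨ *-monoˡ-≤ A (∑-mono f≤0) ⟩
    ∑ {n} (λ _ → 0) * A    ≡⟨ cong (_* A) (trans (∑-const n 0) (*-zeroʳ (2 ^ n))) ⟩
    0                      ≤⟨ z≤n ⟩
    2 * K                  ∎
  go (suc M) f A f≤M tail = begin
    ∑ f * A
      ≡⟨ cong (_* A) (trans (∑-cong (1⊓m+pred[m]≡m ∘ f)) (∑-+ (λ F → 1 ⊓ f F) (pred ∘ f))) ⟩
    (∑ (λ F → 1 ⊓ f F) + ∑ (pred ∘ f)) * A
      ≡⟨ *-distribʳ-+ A (∑ (λ F → 1 ⊓ f F)) _ ⟩
    ∑ (λ F → 1 ⊓ f F) * A + ∑ (pred ∘ f) * A
      ≤⟨ +-mono-≤ head (*-cancelˡ-≤ 2 (≤-trans (≤-reflexive (double (∑ (pred ∘ f)) A))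
           (go M (pred ∘ f) (2 * A) (pred-mono-≤ ∘ f≤M) tail′))) ⟩
    K + K
      ≡⟨ cong (K +_) (+-identityʳ K) ⟨
    2 * K ∎
    where
    head : ∑ (λ F → 1 ⊓ f F) * A ≤ K
    head = subst (λ B → ∑ (λ F → 1 ⊓ f F) * B ≤ K) (*-identityʳ A) (tail 0)
    tail′ : ∀ s → ∑ (λ F → 1 ⊓ (pred (f F) ∸ s)) * (2 * A * 2 ^ s) ≤ K
    tail′ s = begin
      ∑ (λ F → 1 ⊓ (pred (f F) ∸ s)) * (2 * A * 2 ^ s)
        ≡⟨ cong₂ _*_ (∑-cong (λ F → cong (1 ⊓_) (pred[m]∸n (f F) s))) (swap-2 A (2 ^ s)) ⟩
      ∑ (λ F → 1 ⊓ (f F ∸ suc s)) * (A * 2 ^ suc s)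
        ≤⟨ tail (suc s) ⟩
      K ∎

-- Successive refinements and the sets that split a given pair.

module _ {k n : ℕ} (T : TransitionStructure k n) where
  open TransitionStructure T

  refinement : Subset n → ℕ → Partition n
  refinement F zero    = initial F
  refinement F (suc r) = refine T (refinement F r)

  Related : Subset n → ℕ → Fin n → Fin n → Set
  Related F r = Partition._∼_ (refinement F r)

  related? : ∀ F r p q → Dec (Related F r p q)
  related? F r = Partition._∼?_ (refinement F r)

  SplitAfter : ℕ → Fin n → Fin n → Subset n → Set
  SplitAfter r p q F = Related F r p q × ¬ Related F (suc r) p q

  splitAfter? : ∀ r p q F → Dec (SplitAfter r p q F)
  splitAfter? r p q F = related? F r p q ×-dec ¬? (related? F (suc r) p q)

  related⇒lookup : ∀ F r {p q} → Related F r p q → lookup F p ≡ lookup F q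
  related⇒lookup F zero    e = e
  related⇒lookup F (suc r) e = related⇒lookup F r (proj₁ e)

  -- Equivalence classes as subsets, to serve as the certificates in `add`.
  block : Subset n → ℕ → Fin n → Subset n
  block F r p = tabulate λ x → does (related? F r p x)

  lookup-block : ∀ F r p x → lookup (block F r p) x ≡ does (related? F r p x)
  lookup-block F r p = lookup∘tabulate _

  block-agrees : ∀ F r p {x y} → Related F r x y → lookup (block F r p) x ≡ lookup (block F r p) y
  block-agrees F r p {x} {y} x∼y = trans (lookup-block F r p x) (trans
    (does-⇔ (mk⇔ (λ p∼x → ∼-trans p∼x x∼y) (λ p∼y → ∼-trans p∼y (∼-sym x∼y)))
      (related? F r p x) (related? F r p y))
    (sym (lookup-block F r p y)))
    where open Partition (refinement F r)

  block-separates : ∀ F r p {q} → ¬ Related F r p q → lookup (block F r p) p ≢ lookup (block F r p) q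
  block-separates F r p {q} p≁q eq with trans (sym (lookup-block F r p p)) (trans eq (lookup-block F r p q))
  ... | eq′ rewrite dec-true (related? F r p p) (Partition.∼-refl (refinement F r))
    with related? F r p q
  ... | yes p∼q = p≁q p∼q

  -- Induction on `r`, accumulating the pairs met so far in `es`. These are related one level deeper
  -- than the current pair, so the class of `p` at level `suc r` is constant on them while it
  -- separates `p` from `q`: it certifies the new edge.
  splitting-edges :
    ∀ F₀ r {p q es} → SplitAfter r p q F₀ → Acyclic es →
    All (λ (x , y) → Related F₀ (suc r) x y) es →
    ∃[ es′ ] Acyclic es′ × length es′ ≡ suc r + length es ×
             (∀ F → Related F r p q → Agree F es → Agree F es′)
  splitting-edges F₀ r {p} {q} {es} (p∼q , p≁q) ac es∼ with
    add (block F₀ (suc r) p) (All.map (block-agrees F₀ (suc r) p) es∼)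
        (block-separates F₀ (suc r) p p≁q) ac
  splitting-edges F₀ zero {p} {q} {es} _ _ _ | ac′ =
    (p , q) ∷ es , ac′ , refl , λ F → _∷_
  splitting-edges F₀ (suc r) {p} {q} {es} (p∼q , p≁q) ac es∼ | ac′ =
    -- As `p` and `q` are still related at level `suc r`, only a letter can split them at the next.
    -- The choice of `a` depends on `F₀` alone, yet any `F` relating `p` and `q` at level `suc r`
    -- relates their images under `a` at level `r`.
    let a , pa≁qa = ¬∀⟶∃¬ k _ (λ a → related? F₀ (suc r) (p · a) (q · a)) (λ all → p≁q (p∼q , all))
        es′ , ac″ , len , ext = splitting-edges F₀ r (proj₂ p∼q a , pa≁qa) ac′ (p∼q ∷ All.map proj₁ es∼)
    in es′ , ac″ , trans len (+-suc (suc r) (length es))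
     , λ F p∼q as → ext F (proj₂ p∼q a) (related⇒lookup F (suc r) p∼q ∷ as)

  splitAfter-count : ∀ r p q → ∑ (λ F → ⟦ splitAfter? r p q F ⟧) * 2 ^ suc r ≤ 2 ^ n
  splitAfter-count r p q with anySubset? (splitAfter? r p q)
  ... | no none = begin
    ∑ (λ F → ⟦ splitAfter? r p q F ⟧) * 2 ^ suc r
      ≤⟨ *-monoˡ-≤ (2 ^ suc r) (∑-mono λ F → ⟦⟧-mono (splitAfter? r p q F) (no id) λ s → none (F , s)) ⟩
    ∑ {n} (λ _ → 0) * 2 ^ suc r
      ≡⟨ cong (_* 2 ^ suc r) (trans (∑-const n 0) (*-zeroʳ (2 ^ n))) ⟩
    0
      ≤⟨ z≤n ⟩
    2 ^ n ∎
  ... | yes (F₀ , split) with splitting-edges F₀ r split [] []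
  ... | es , ac , len , ext = begin
    ∑ (λ F → ⟦ splitAfter? r p q F ⟧) * 2 ^ suc r
      ≤⟨ *-monoˡ-≤ (2 ^ suc r) (∑-mono λ F →
           ⟦⟧-mono (splitAfter? r p q F) (agree? F es) λ s → ext F (proj₁ s) []) ⟩
    ∑ (λ F → ⟦ agree? F es ⟧) * 2 ^ suc r
      ≡⟨ cong (λ l → ∑ (λ F → ⟦ agree? F es ⟧) * 2 ^ l) (trans len (+-identityʳ (suc r))) ⟨
    ∑ (λ F → ⟦ agree? F es ⟧) * 2 ^ length es
      ≤⟨ acyclic-count ac ⟩
    2 ^ n ∎

  -- From the number of iterations to split pairs, and the bound on the sum.

  loop-changes : ∀ F i {m} → Loop T (just (refinement F i)) (refinement F (suc i)) m →
                 ∀ {r} → i ≤ r → r < i + m → ¬ (refinement F r ≐ refinement F (suc r))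
  loop-changes F i (exit _) i≤r r<i+0 =
    contradiction (≤-<-trans i≤r r<i+0) (<-irrefl (sym (+-identityʳ i)))
  loop-changes F i (iterate {m = m} changed l) {r} i≤r r<i+m with m≤n⇒m<n∨m≡n i≤r
  ... | inj₁ i<r  = loop-changes F (suc i) l i<r (subst (r <_) (+-suc i m) r<i+m)
  ... | inj₂ refl = changed

  -- Refinement only removes related pairs, so a change means that some pair is lost; decidability
  -- makes it possible to search for one.
  changed⇒split : ∀ F r → ¬ (refinement F r ≐ refinement F (suc r)) → ∃[ p ] ∃[ q ] SplitAfter r p q F
  changed⇒split F r changed with any? (λ p → any? λ q → splitAfter? r p q F)
  ... | yes found = found
  ... | no none = contradiction (λ p q → mk⇔ (stays p q) proj₁) changed
    where
    stays : ∀ p q → Related F r p q → Related F (suc r) p q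
    stays p q p∼q = decidable-stable (related? F (suc r) p q) λ p≁q → none (p , q , p∼q , p≁q)

  Moore⇒split : ∀ F r → suc r < Moore T F → ∃[ p ] ∃[ q ] SplitAfter r p q F
  Moore⇒split F r r+1<m with mooreRun T F
  -- The first iteration compares with the undefined partition and splits nothing; this accounts for
  -- the shift by one.
  ... | suc _ , run _ (iterate _ l) = changed⇒split F r (loop-changes F 0 l z≤n (s≤s⁻¹ r+1<m))

  -- Union bound over the n² pairs of states, using `splitAfter-count` for each.
  Moore-tail : ∀ r → ∑ (λ F → 1 ⊓ (Moore T F ∸ suc r)) * 2 ^ suc r ≤ n * (n * 2 ^ n)
  Moore-tail r = begin
    ∑ (λ F → 1 ⊓ (Moore T F ∸ suc r)) * 2 ^ suc r
      ≤⟨ *-monoˡ-≤ (2 ^ suc r) (∑-mono indicator) ⟩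
    ∑ (λ F → sum (map (λ p → h p F) (allFin n))) * 2 ^ suc r
      ≤⟨ ∑-sum-bound h (2 ^ suc r) (n * 2 ^ n) (λ p → subst (λ l → ∑ (h p) * 2 ^ suc r ≤ l * 2 ^ n) length-allFin
           (∑-sum-bound (g p) (2 ^ suc r) (2 ^ n) (splitAfter-count r p) (allFin n))) (allFin n) ⟩
    length (allFin n) * (n * 2 ^ n)
      ≡⟨ cong (_* (n * 2 ^ n)) length-allFin ⟩
    n * (n * 2 ^ n) ∎
    where
    length-allFin : length (allFin n) ≡ n
    length-allFin = length-tabulate id
    g : Fin n → Fin n → Subset n → ℕ
    g p q F = ⟦ splitAfter? r p q F ⟧
    h : Fin n → Subset n → ℕ
    h p F = sum (map (λ q → g p q F) (allFin n))
    indicator : ∀ F → 1 ⊓ (Moore T F ∸ suc r) ≤ sum (map (λ p → h p F) (allFin n))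
    indicator F with suc r <? Moore T F
    ... | no r+1≮m rewrite m≤n⇒m∸n≡0 (≮⇒≥ r+1≮m) = z≤n
    ... | yes r+1<m = let p , q , split = Moore⇒split F r r+1<m in begin
      1 ⊓ (Moore T F ∸ suc r)               ≤⟨ m⊓n≤m 1 _ ⟩
      1                                     ≤⟨ ⟦yes⟧ (splitAfter? r p q F) split ⟩
      g p q F                               ≤⟨ ∈⇒≤sum (λ q → g p q F) (∈-allFin q) ⟩
      h p F                                 ≤⟨ ∈⇒≤sum (λ p → h p F) (∈-allFin p) ⟩
      sum (map (λ p → h p F) (allFin n))    ∎

  ∑-Moore-≤ : ∑ (Moore T) ≤ 2 ^ n * (4 + 2 * ⌊log₂ n ⌋)
  ∑-Moore-≤ = begin
    ∑ (Moore T)                                ≤⟨ ∑-mono (λ F → m≤n+m∸n (Moore T F) D) ⟩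
    ∑ (λ F → D + (Moore T F ∸ D))              ≡⟨ ∑-+ (λ _ → D) (λ F → Moore T F ∸ D) ⟩
    ∑ {n} (λ _ → D) + ∑ (λ F → Moore T F ∸ D)  ≤⟨ +-mono-≤ (≤-reflexive (∑-const n D)) excess ⟩
    2 ^ n * D + 2 ^ n                          ≡⟨ rearrange (2 ^ n) ⌊log₂ n ⌋ ⟩
    2 ^ n * (4 + 2 * ⌊log₂ n ⌋)                ∎
    where
    L D : ℕ
    L = suc ⌊log₂ n ⌋
    -- Since n² ≤ 2^(2L), the tail beyond `D` starts below one half of all sets. The extra 1 in `D`
    -- cancels the factor 2 of `∑-geometric`, so the average excess over `D` is at most 1.
    D = suc (L + L)
    rearrange : ∀ N l → N * suc (suc l + suc l) + N ≡ N * (4 + 2 * l)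
    rearrange = solve-∀
    tail : ∀ s → ∑ (λ F → 1 ⊓ (Moore T F ∸ D ∸ s)) * (2 * 2 ^ s) ≤ 2 ^ n
    tail s = *-cancelʳ-≤ _ _ (2 ^ (L + L)) {{m^n≢0 2 (L + L)}} (begin
      ∑ (λ F → 1 ⊓ (Moore T F ∸ D ∸ s)) * (2 * 2 ^ s) * 2 ^ (L + L)
        ≡⟨ cong (λ c → c * (2 * 2 ^ s) * 2 ^ (L + L))
             (∑-cong λ F → cong (1 ⊓_) (∸-+-assoc (Moore T F) D s)) ⟩
      ∑ (λ F → 1 ⊓ (Moore T F ∸ (D + s))) * (2 * 2 ^ s) * 2 ^ (L + L)
        ≡⟨ shift (∑ (λ F → 1 ⊓ (Moore T F ∸ (D + s)))) (2 ^ s) (2 ^ (L + L)) ⟩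
      ∑ (λ F → 1 ⊓ (Moore T F ∸ (D + s))) * (2 * (2 ^ (L + L) * 2 ^ s))
        ≡⟨ cong (λ c → ∑ (λ F → 1 ⊓ (Moore T F ∸ (D + s))) * (2 * c)) (^-distribˡ-+-* 2 (L + L) s) ⟨
      ∑ (λ F → 1 ⊓ (Moore T F ∸ (D + s))) * 2 ^ (D + s)
        ≤⟨ Moore-tail (L + L + s) ⟩
      n * (n * 2 ^ n)
        ≤⟨ *-mono-≤ n≤2^L (*-monoˡ-≤ (2 ^ n) n≤2^L) ⟩
      2 ^ L * (2 ^ L * 2 ^ n)
        ≡⟨ square (2 ^ L) (2 ^ n) ⟩
      2 ^ n * (2 ^ L * 2 ^ L)
        ≡⟨ cong (2 ^ n *_) (^-distribˡ-+-* 2 L L) ⟨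
      2 ^ n * 2 ^ (L + L) ∎)
      where
      n≤2^L = <⇒≤ (n<2^[1+⌊log₂n⌋] n)
      shift : ∀ a b c → a * (2 * b) * c ≡ a * (2 * (c * b))
      shift = solve-∀
      square : ∀ a b → a * (a * b) ≡ b * (a * a)
      square = solve-∀
    excess : ∑ (λ F → Moore T F ∸ D) ≤ 2 ^ n
    excess = *-cancelʳ-≤ _ _ 2 (subst (∑ (λ F → Moore T F ∸ D) * 2 ≤_) (*-comm 2 (2 ^ n))
      (∑-geometric (λ F → Moore T F ∸ D) 2 (2 ^ n) tail))

-- Passage to a multiple of the real logarithm.

-- The additive constant is absorbed by 4 ⌊log₂ n⌋ once n ≥ 2; for n = 1 only
-- F = ∅ and F = {1} exist, on which the main loop is not entered.
∑-Moore-≤-log : ∀ {k} n → .{{NonZero n}} → (T : TransitionStructure k n) →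
                ∑ (Moore T) ≤ 6 * ⌊log₂ n ⌋ * 2 ^ n
∑-Moore-≤-log 1 T = ≤-refl
∑-Moore-≤-log n@(suc (suc _)) T = begin
  ∑ (Moore T)                            ≤⟨ ∑-Moore-≤ T ⟩
  2 ^ n * (4 + 2 * ⌊log₂ n ⌋)            ≤⟨ *-monoʳ-≤ (2 ^ n) (+-monoˡ-≤ _ (*-monoʳ-≤ 4 1≤log)) ⟩
  2 ^ n * (4 * ⌊log₂ n ⌋ + 2 * ⌊log₂ n ⌋)  ≡⟨ rearrange (2 ^ n) ⌊log₂ n ⌋ ⟩
  6 * ⌊log₂ n ⌋ * 2 ^ n                  ∎
  where
  1≤log : 1 ≤ ⌊log₂ n ⌋
  1≤log = ⌊log₂⌋-mono-≤ {2} {n} (s≤s (s≤s z≤n))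
  rearrange : ∀ N l → N * (4 * l + 2 * l) ≡ 6 * l * N
  rearrange = solve-∀

-- Comes from the j-th power of 2^⌊log₂ n⌋ ≤ n. Hence every rational approximant of log₂ n is at
-- least ⌊log₂ n⌋.
⌊log₂⌋-*-≤ : ∀ n j → .{{NonZero n}} → ⌊log₂ n ⌋ * j ≤ ⌊log₂ n ^ j ⌋
⌊log₂⌋-*-≤ n j = begin
  ⌊log₂ n ⌋ * j                ≡⟨ ⌊log₂[2^n]⌋≡n (⌊log₂ n ⌋ * j) ⟨
  ⌊log₂ 2 ^ (⌊log₂ n ⌋ * j) ⌋  ≡⟨ cong ⌊log₂_⌋ (^-*-assoc 2 ⌊log₂ n ⌋ j) ⟨
  ⌊log₂ (2 ^ ⌊log₂ n ⌋) ^ j ⌋  ≤⟨ ⌊log₂⌋-mono-≤ (^-monoˡ-≤ j (2^⌊log₂n⌋≤n n)) ⟩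
  ⌊log₂ n ^ j ⌋                ∎

/-*-/ : ∀ a b j → (ℤ.+ a ℚ./ 1) ℚ.* (ℤ.+ b ℚ./ suc j) ≡ ℤ.+ (a * b) ℚ./ suc j
/-*-/ a b j = ℚ.toℚᵘ-injective (R.begin
  ℚ.toℚᵘ ((ℤ.+ a ℚ./ 1) ℚ.* (ℤ.+ b ℚ./ suc j))
    R.≈⟨ ℚ.toℚᵘ-homo-* (ℤ.+ a ℚ./ 1) (ℤ.+ b ℚ./ suc j) ⟩
  ℚ.toℚᵘ (ℤ.+ a ℚ./ 1) ℚᵘ.* ℚ.toℚᵘ (ℤ.+ b ℚ./ suc j)
    R.≈⟨ ℚᵘ.*-cong (ℚ.toℚᵘ-fromℚᵘ (ℚᵘ.mkℚᵘ (ℤ.+ a) 0)) (ℚ.toℚᵘ-fromℚᵘ (ℚᵘ.mkℚᵘ (ℤ.+ b) j)) ⟩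
  ℚᵘ.mkℚᵘ (ℤ.+ a) 0 ℚᵘ.* ℚᵘ.mkℚᵘ (ℤ.+ b) j
    R.≈⟨ ℚᵘ.*≡* (cong₂ ℤ._*_ (sym (ℤ.pos-* a b)) (cong (λ d → ℤ.+ suc d) (sym (+-identityʳ j)))) ⟩
  ℚᵘ.mkℚᵘ (ℤ.+ (a * b)) j
    R.≈⟨ ℚ.toℚᵘ-fromℚᵘ (ℚᵘ.mkℚᵘ (ℤ.+ (a * b)) j) ⟨
  ℚ.toℚᵘ (ℤ.+ (a * b) ℚ./ suc j) R.∎)
  where module R where open import Relation.Binary.Reasoning.Setoid ℚᵘ.≃-setoid public

average-Moore-≤ : ∀ {k n} → .{{_ : NonZero n}} → (T : TransitionStructure k n) → ∀ j →
                  average (Moore T) ℚ.≤ (ℤ.+ 6 ℚ./ 1) ℚ.* log₂-approx n j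
average-Moore-≤ {n = n} T j = subst (average (Moore T) ℚ.≤_) (sym (/-*-/ 6 ⌊log₂ n ^ suc j ⌋ j))
  (/-mono-≤ (sum (map (Moore T) (subsets n))) (2 ^ n) (6 * ⌊log₂ n ^ suc j ⌋) (suc j) {{m^n≢0 2 n}} (begin
    sum (map (Moore T) (subsets n)) * suc j  ≡⟨ cong (_* suc j) (sum-subsets n (Moore T)) ⟩
    ∑ (Moore T) * suc j                      ≤⟨ *-monoˡ-≤ (suc j) (∑-Moore-≤-log n T) ⟩
    6 * ⌊log₂ n ⌋ * 2 ^ n * suc j            ≡⟨ rearrange ⌊log₂ n ⌋ (2 ^ n) (suc j) ⟩
    6 * (⌊log₂ n ⌋ * suc j) * 2 ^ n          ≤⟨ *-monoˡ-≤ (2 ^ n) (*-monoʳ-≤ 6 (⌊log₂⌋-*-≤ n (suc j))) ⟩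
    6 * ⌊log₂ n ^ suc j ⌋ * 2 ^ n            ∎))
  where
  rearrange : ∀ l N j → 6 * l * N * j ≡ 6 * (l * j) * N
  rearrange = solve-∀

proposition3p4 : ∀ (k : ℕ) → 1 ≤ k →
    ∃[ C ] Positiveᴿ C ×
    (∀ (n : ℕ) → .{{_ : NonZero n}} →
    ∀ (T : TransitionStructure k n) → TransitionStructure.Accessible T →
    fromℚ (average (Moore T)) ≤ᴿ C *ᴿ log₂ n)
-- The constant is 6 = 4 + 2, as in `∑-Moore-≤-log`. The inequality holds at every index of the
-- approximating sequence, so the threshold is 0 and ε is mere slack.
proposition3p4 k _ = fromℚ 6ℚ
  , (6ℚ , ℚ.positive⁻¹ 6ℚ , 0 , λ _ _ → ℚ.≤-refl)
  , λ n T _ ε ε>0 → 0 , λ j _ →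
      subst (ℚ._≤ 6ℚ ℚ.* log₂-approx n j ℚ.+ ε) (ℚ.+-identityʳ _)
        (ℚ.+-mono-≤ (average-Moore-≤ T j) (ℚ.<⇒≤ ε>0))
  where
  6ℚ : ℚ
  6ℚ = ℤ.+ 6 ℚ./ 1
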